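{- For every $n \ge 5$, there exists a tree $T$ on $n$ vertices such that, with $\Gamma$ the Cayley graph of $S_n$ generated by $T$, the difference between the diameter upper bound $f(T)$ and the actual diameter $\mathrm{diam}(\Gamma)$ is at least $n-4$; in other words, $\Delta_n \ge n-4$.
   Context: $S_n$ is the symmetric group on $\{1,\ldots,n\}$; the product $\pi\tau$ means apply $\tau$ first, then $\pi$. For a tree $T$ on vertex set $\{1,\ldots,n\}$ (a transposition tree), each edge $ij$ is identified with the transposition $(i,j)$, and the Cayley graph $\Gamma$ generated by $T$ is the simple undirected graph with vertex set $S_n$ in which $g$ and $h$ are adjacent iff $h = gs$ for some transposition $s$ that is an edge of $T$. $\mathrm{dist}_G$ and $\mathrm{diam}(G)$ denote distance and diameter in a graph $G$. $c(\pi)$ is the number of cycles of $\pi$, including cycles of length 1. The diameter upper bound is $$f(T) := \max_{\pi \in S_n} \left\{c(\pi)-n+\sum_{i=1}^n \mathrm{dist}_T(i,\pi(i))\right\},$$ which is known to satisfy $\mathrm{diam}(\Gamma) \le f(T)$. Define $$\Delta_n := \max_{T \in \mathcal{T}_n} |f(T) - \mathrm{diam}(\Gamma)|,$$ where $\mathcal{T}_n$ is the set of all trees on $n$ vertices and, for each $T\in\mathcal{T}_n$, $\Gamma$ is the Cayley graph generated by $T$. -}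

module Defs where

open import Level using (0ℓ)
open import Data.Nat using (ℕ; zero; suc; _+_; _≤_)
open import Data.Nat.GeneralisedArithmetic using (iterate)
open import Data.Nat.Properties using (+-0-monoid)
open import Data.Integer as ℤ using (ℤ; +_; ∣_∣)
open import Data.Fin using (Fin; zero; suc; inject₁; fromℕ)
open import Data.Fin.Properties using (_≟_; any?; all?)
open import Data.Fin.Permutation using (Permutation′; _⟨$⟩ʳ_; _∘ₚ_; transpose)
  renaming (_≈_ to _≈ₚ_)
import Data.Fin.Permutation.Components as PC
open import Data.Product using (Σ-syntax; ∃-syntax; ∃₂; _×_; _,_; uncurry)
open import Algebra.Properties.Monoid.Sum +-0-monoid using (sum)
open import Function.Bundles using (_⇔_; Injection)
open import Function.Properties.Inverse using (↔⇒↣)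
open import Function.Definitions using (Injective; Surjective)
open import Relation.Binary
  using (Rel; Setoid; Symmetric; Irreflexive; Decidable; _Respects₂_)
open import Relation.Binary.PropositionalEquality
  using (_≡_; _≢_; refl; sym; trans; cong; module ≡-Reasoning)
import Relation.Binary.PropositionalEquality as ≡
open import Relation.Nullary using (¬_; Dec; yes; no; contradiction)
open import Relation.Nullary.Decidable using (_×-dec_)

-- R is the graph of a function from A to B; the second component also
-- says that this function is defined everywhere on A.
IsMaximumOver : ∀ {a} {A : Set a} {B : Set} → Rel B 0ℓ → (A → B → Set) → B → Set a
IsMaximumOver {A = A} _≤_ R m =
  (∃[ x ] R x m) × (∀ (x : A) → ∃[ b ] (R x b × b ≤ m))

-- The vertices form a setoid because permutations are compared pointwise.
record SimpleGraph (S : Setoid 0ℓ 0ℓ) : Set₁ where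
  open Setoid S using (_≈_) renaming (Carrier to V)
  infix 4 _~_
  field
    _~_      : Rel V 0ℓ
    ~-resp-≈ : _~_ Respects₂ _≈_
    ~-sym    : Symmetric _~_
    ~-irrefl : Irreflexive _≈_ _~_
    _~?_     : Decidable _~_

module _ {S : Setoid 0ℓ 0ℓ} (G : SimpleGraph S) where
  open Setoid S using (_≈_) renaming (Carrier to V)
  open SimpleGraph G

  data Walk : V → V → ℕ → Set where
    nil  : ∀ {u v} → u ≈ v → Walk u v 0
    cons : ∀ {u v w k} → u ~ v → Walk v w k → Walk u w (suc k)

  IsDist : V → V → ℕ → Set
  IsDist u v d = Walk u v d × (∀ k → Walk u v k → d ≤ k)

  -- Holds for no D if the graph is disconnected.
  IsDiameter : ℕ → Set
  IsDiameter = IsMaximumOver _≤_ (uncurry IsDist)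

  Connected : Set
  Connected = ∀ u v → ∃[ k ] Walk u v k

  -- A cycle of length 3 + m, listed by its distinct vertices.
  Cycle : ℕ → Set
  Cycle m = Σ[ c ∈ (Fin (3 + m) → V) ]
    Injective _≡_ _≈_ c ×
    (∀ (i : Fin (2 + m)) → c (inject₁ i) ~ c (suc i)) ×
    c (fromℕ (2 + m)) ~ c zero

  Acyclic : Set
  Acyclic = ∀ m → ¬ Cycle m

record Tree (n : ℕ) : Set₁ where
  field
    graph     : SimpleGraph (≡.setoid (Fin n))
    connected : Connected graph
    acyclic   : Acyclic graph

S[_] : ℕ → Setoid 0ℓ 0ℓ
S[ n ] = record
  { Carrier       = Permutation′ n
  ; _≈_           = _≈ₚ_
  ; isEquivalence = record
    { refl  = λ _ → refl
    ; sym   = λ p i → sym (p i)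
    ; trans = λ p q i → trans (p i) (q i)
    }
  }

-- _∘ₚ_ applies its left argument first, whereas π · τ applies τ first.
infixl 7 _·_
_·_ : ∀ {n} → Permutation′ n → Permutation′ n → Permutation′ n
π · τ = τ ∘ₚ π

SameCycle : ∀ {n} → Permutation′ n → Rel (Fin n) 0ℓ
SameCycle π i j = ∃[ k ] iterate (π ⟨$⟩ʳ_) i k ≡ j

-- π has exactly c cycles (fixed points included): some labelling by Fin c
-- uses every label and separates precisely the different cycles.
HasCycles : ∀ {n} → Permutation′ n → ℕ → Set
HasCycles {n} π c = Σ[ label ∈ (Fin n → Fin c) ]
  Surjective _≡_ _≡_ label ×
  (∀ i j → label i ≡ label j ⇔ SameCycle π i j)

module _ {n : ℕ} (G : SimpleGraph (≡.setoid (Fin n))) where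
  open SimpleGraph G

  CayleyAdj : Rel (Permutation′ n) 0ℓ
  CayleyAdj g h = ∃₂ λ i j → i ~ j × h ≈ₚ g · transpose i j

  private
    transpose-matchˡ : ∀ (i j : Fin n) → PC.transpose i j i ≡ j
    transpose-matchˡ i j with i ≟ i
    ... | yes _  = refl
    ... | no i≢i = contradiction refl i≢i

    transpose-matchʳ : ∀ (i j : Fin n) → PC.transpose i j j ≡ i
    transpose-matchʳ i j with j ≟ i
    ... | yes j≡i = j≡i
    ... | no _ with j ≟ j
    ...   | yes _  = refl
    ...   | no j≢j = contradiction refl j≢j

    transpose-other : ∀ (i j : Fin n) {k} → k ≢ i → k ≢ j → PC.transpose i j k ≡ k
    transpose-other i j {k} k≢i k≢j with k ≟ i
    ... | yes k≡i = contradiction k≡i k≢i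
    ... | no _ with k ≟ j
    ...   | yes k≡j = contradiction k≡j k≢j
    ...   | no _    = refl

    transpose-involutive : ∀ (i j k : Fin n) →
      PC.transpose i j (PC.transpose i j k) ≡ k
    transpose-involutive i j k = by-cases (k ≟ i) (k ≟ j)
      where
      t = PC.transpose i j
      by-cases : Dec (k ≡ i) → Dec (k ≡ j) → t (t k) ≡ k
      by-cases (yes refl) _ = trans (cong t (transpose-matchˡ i j)) (transpose-matchʳ i j)
      by-cases (no _) (yes refl) = trans (cong t (transpose-matchʳ i j)) (transpose-matchˡ i j)
      by-cases (no k≢i) (no k≢j) =
        trans (cong t (transpose-other i j k≢i k≢j)) (transpose-other i j k≢i k≢j)

    adj-sym : Symmetric CayleyAdj
    adj-sym {g} {h} (i , j , i~j , h≈gs) = i , j , i~j , λ k →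
      trans (cong (g ⟨$⟩ʳ_) (sym (transpose-involutive i j k)))
            (sym (h≈gs (PC.transpose i j k)))

    adj-irrefl : Irreflexive _≈ₚ_ CayleyAdj
    adj-irrefl {g} {h} g≈h (i , j , i~j , h≈gs) = ~-irrefl i≡j i~j
      where
      open ≡-Reasoning
      i≡j : i ≡ j
      i≡j = Injection.injective (↔⇒↣ g) (begin
        g ⟨$⟩ʳ i                     ≡⟨ g≈h i ⟩
        h ⟨$⟩ʳ i                     ≡⟨ h≈gs i ⟩
        g ⟨$⟩ʳ PC.transpose i j i    ≡⟨ cong (g ⟨$⟩ʳ_) (transpose-matchˡ i j) ⟩
        g ⟨$⟩ʳ j                     ∎)

  Cayley : SimpleGraph S[ n ]
  Cayley = record
    { _~_      = CayleyAdj
    ; ~-resp-≈ =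
        (λ h≈h′ (i , j , i~j , p) → i , j , i~j , λ k → trans (sym (h≈h′ k)) (p k)) ,
        (λ g≈g′ (i , j , i~j , p) → i , j , i~j , λ k → trans (p k) (g≈g′ (PC.transpose i j k)))
    ; ~-sym    = λ {g} {h} → adj-sym {g} {h}
    ; ~-irrefl = λ {g} {h} → adj-irrefl {g} {h}
    ; _~?_     = λ g h → any? λ i → any? λ j → (i ~? j) ×-dec
        all? λ k → (h ⟨$⟩ʳ k) ≟ (g · transpose i j ⟨$⟩ʳ k)
    }

module _ {n : ℕ} (T : Tree n) where
  open Tree T

  BoundTerm : Permutation′ n → ℤ → Set
  BoundTerm π v = Σ[ c ∈ ℕ ] Σ[ d ∈ (Fin n → ℕ) ]
    HasCycles π c ×
    (∀ i → IsDist graph i (π ⟨$⟩ʳ i) (d i)) ×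
    v ≡ (+ c) ℤ.- (+ n) ℤ.+ (+ sum d)

  -- f(T) = max over π of c(π) − n + Σᵢ dist_T(i, π(i)).  It is taken in ℤ to
  -- avoid truncated subtraction.
  IsDiameterUpperBound : ℤ → Set
  IsDiameterUpperBound = IsMaximumOver ℤ._≤_ BoundTerm

  IsGap : ℕ → Set
  IsGap δ = Σ[ f ∈ ℤ ] Σ[ D ∈ ℕ ]
    IsDiameterUpperBound f × IsDiameter (Cayley graph) D × δ ≡ ∣ f ℤ.- (+ D) ∣

-- Δₙ = max over T of |f(T) − diam(Γ)|.
IsΔ : ℕ → ℕ → Set₁
IsΔ n = IsMaximumOver {A = Tree n} _≤_ IsGap

{-# OPTIONS --safe #-}

-- The tree is a path whose last vertex is doubled (a fork).
-- Bringing the token of the leaf 0 home takes at most n − 2 exchanges and leaves the same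
-- problem on the fork with n − 1 vertices; the recursion ends at the star on four vertices,
-- whose Cayley graph has diameter 4.  Hence the diameter is at most (n − 1)(n − 2)/2 + 1.
-- The reversal i ↦ n − 1 − i has ⌈n/2⌉ cycles and moves the points by a total of ⌊n²/2⌋ − 2,
-- so it shows that f(T) ≥ n(n − 1)/2 − 2.
module Submission where

open import Defs
open import Data.Fin using (Fin; zero; suc; toℕ; fromℕ; fromℕ<; inject₁; inject≤; punchIn; opposite)
open import Data.Fin.Patterns using (0F; 1F; 2F; 3F)
open import Data.Fin.Permutation
  using (Permutation′; _⟨$⟩ʳ_; _⟨$⟩ˡ_; inverseʳ; id; flip; transpose; insert; remove; insert-remove;
         lift₀; lift₀-remove; lift₀-transpose)
  renaming (_≈_ to _≈ₚ_; reverse to reversal)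
import Data.Fin.Permutation.Components as PC
import Data.Fin.Properties as Fin
open import Data.Fin.Relation.Unary.Top using (view; ‵fromℕ; ‵inject₁)
import Data.Integer.Properties as ℤ
open import Data.List using (List; []; _∷_; allFin; cartesianProductWith)
open import Data.List.Extrema using (argmax; f[xs]≤f[argmax])
open import Data.List.Membership.Propositional using (find)
open import Data.List.Membership.Propositional.Properties using (∈-allFin)
import Data.List.Relation.Unary.All as All
open import Data.List.Relation.Unary.Any as Any using (Any; here)
import Data.List.Relation.Unary.Any.Properties as Any
open import Data.Nat
  using (ℕ; zero; suc; _+_; _*_; _∸_; _⊓_; ∣_-_∣; ⌈_/2⌉; ⌊_/2⌋; _≤_; _<_; z≤n; s≤s)
open import Data.Nat.DivMod using (_/_; _%_; m≡m%n+[m/n]*n; m%n<n)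
open import Data.Nat.GeneralisedArithmetic using (iterate)
import Data.Nat.Properties as ℕ
open import Algebra.Properties.Monoid.Sum ℕ.+-0-monoid using (sum; sum-init-last; sum-cong-≗)
open import Data.Nat.Tactic.RingSolver using (solve-∀)
open import Data.Product using (Σ-syntax; ∃-syntax; ∃₂; _×_; _,_; proj₁; proj₂)
open import Data.Sum as Sum using (_⊎_; inj₁; inj₂)
open import Data.Vec.Functional using (Vector)
open import Function using (_∘_; _⇔_; mk⇔; Injection; Equivalence)
open import Function.Definitions using (Injective; Surjective)
open import Function.Properties.Inverse using (↔⇒↣)
open import Level using (0ℓ)
open import Relation.Binary
  using (Rel; Setoid; TotalOrder; Decidable; IsEquivalence; IsTotalOrder)
import Relation.Binary.Construct.On as On
open import Relation.Binary.PropositionalEquality as ≡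
  using (_≡_; _≢_; _≗_; refl; sym; trans; cong; cong₂; subst; module ≡-Reasoning)
open import Relation.Nullary using (¬_; Dec; yes; no; contradiction)
open import Relation.Nullary.Decidable
  using (map′; _×-dec_; _⊎-dec_; _→-dec_; from-yes; dec-true)
import Relation.Unary as U

-- Least witnesses and maxima over finite lists

least : {P : ℕ → Set} → U.Decidable P → ∀ k → P k → ∃[ d ] P d × (∀ j → P j → d ≤ j)
least P? k Pk with P? 0
... | yes P0 = 0 , P0 , λ _ _ → z≤n
least P? zero    P0 | no ¬P0 = contradiction P0 ¬P0
least P? (suc k) Pk | no ¬P0 with least (P? ∘ suc) k Pk
... | d , Pd , d≤ = suc d , Pd , λ { zero P0 → contradiction P0 ¬P0 ; (suc j) Pj → s≤s (d≤ j Pj) }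

-- The list need only represent each `x` by some `y` whose values are also values of `x`; this suits
-- permutations, which are listed up to pointwise equality.
maximum-exists : ∀ {A B : Set} {_≈_ _≤_ : Rel B 0ℓ} →
  (O : IsTotalOrder _≈_ _≤_) {R : A → B → Set} (x₀ : A) (xs : List A) →
  (∀ x → Any (λ y → ∀ b → R y b → R x b) xs) → (∀ x → ∃[ b ] R x b) →
  ∃[ m ] IsMaximumOver _≤_ R m
maximum-exists {A} {B} O {R} x₀ xs exhaust total =
  value best , (best , proj₂ (total best)) , λ x →
    let y , y∈xs , Ry⇒Rx = find (exhaust x)
    in value y , Ry⇒Rx _ (proj₂ (total y)) , All.lookup (f[xs]≤f[argmax] order {f = value} x₀ xs) y∈xs
  where
  order : TotalOrder 0ℓ 0ℓ 0ℓ
  order = record { isTotalOrder = O }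
  value : A → B
  value = proj₁ ∘ total
  best : A
  -- The default `x₀` may win without occurring in `xs`; its value is still attained and dominates
  -- those of the list.
  best = argmax order value x₀ xs

-- Walks, distances and diameters in finite graphs

module _ {S : Setoid 0ℓ 0ℓ} (G : SimpleGraph S) where
  open Setoid S using (_≈_) renaming (Carrier to V; refl to ≈-refl; sym to ≈-sym; trans to ≈-trans)
  open SimpleGraph G

  walk-respˡ : ∀ {u v w k} → u ≈ v → Walk G u w k → Walk G v w k
  walk-respˡ u≈v (nil u≈w)      = nil (≈-trans (≈-sym u≈v) u≈w)
  walk-respˡ u≈v (cons u~x x⇝w) = cons (proj₂ ~-resp-≈ u≈v u~x) x⇝w

  walk-respʳ : ∀ {u v w k} → v ≈ w → Walk G u v k → Walk G u w k
  walk-respʳ v≈w (nil u≈v)      = nil (≈-trans u≈v v≈w)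
  walk-respʳ v≈w (cons u~x x⇝v) = cons u~x (walk-respʳ v≈w x⇝v)

  append : ∀ {u v w k l} → Walk G u v k → Walk G v w l → Walk G u w (k + l)
  append (nil u≈v)      v⇝w = walk-respˡ (≈-sym u≈v) v⇝w
  append (cons u~x x⇝v) v⇝w = cons u~x (append x⇝v v⇝w)

  reverse : ∀ {u v k} → Walk G u v k → Walk G v u k
  reverse (nil u≈v) = nil (≈-sym u≈v)
  reverse {k = suc k} (cons u~x x⇝v) =
    subst (Walk G _ _) (ℕ.+-comm k 1) (append (reverse x⇝v) (cons (~-sym u~x) (nil ≈-refl)))

  dist-resp : ∀ {u u′ v v′ d} → u ≈ u′ → v ≈ v′ → IsDist G u v d → IsDist G u′ v′ d
  dist-resp u≈u′ v≈v′ (u⇝v , shortest) =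
    walk-respˡ u≈u′ (walk-respʳ v≈v′ u⇝v) ,
    λ k u′⇝v′ → shortest k (walk-respˡ (≈-sym u≈u′) (walk-respʳ (≈-sym v≈v′) u′⇝v′))

  module _ (_≟_ : Decidable _≈_) (xs : List V) (exhaust : ∀ v → Any (v ≈_) xs) where

    -- Recursion on the length, with every vertex of `xs` tried as the next one. Decidability lets
    -- `least` pick a shortest walk.
    walk? : ∀ u v k → Dec (Walk G u v k)
    walk? u v zero    = map′ nil (λ { (nil u≈v) → u≈v }) (u ≟ v)
    walk? u v (suc k) = map′ to from (Any.any? (λ x → (u ~? x) ×-dec walk? x v k) xs)
      where
      to : Any (λ x → u ~ x × Walk G x v k) xs → Walk G u v (suc k)
      to step with _ , u~x , x⇝v ← Any.satisfied step = cons u~x x⇝v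
      from : Walk G u v (suc k) → Any (λ x → u ~ x × Walk G x v k) xs
      from (cons u~x x⇝v) =
        Any.map (λ x≈y → proj₁ ~-resp-≈ x≈y u~x , walk-respˡ x≈y x⇝v) (exhaust _)

    dist-exists : Connected G → ∀ u v → ∃[ d ] IsDist G u v d
    dist-exists connected u v = let k , u⇝v = connected u v in least (walk? u v) k u⇝v

    diameter-exists : Connected G → V → ∃[ D ] IsDiameter G D
    diameter-exists connected v₀ = maximum-exists ℕ.≤-isTotalOrder (v₀ , v₀)
      (cartesianProductWith _,_ xs xs)
      (λ (u , v) → Any.cartesianProductWith⁺ _,_
        (λ u≈x v≈y _ → dist-resp (≈-sym u≈x) (≈-sym v≈y)) (exhaust u) (exhaust v))
      (λ (u , v) → dist-exists connected u v)

  -- The first, last and inner positions are treated separately. The two indices differ because a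
  -- cycle has at least three vertices.
  cycle-neighbours : ∀ {m} ((c , _) : Cycle G m) i →
    ∃₂ λ j k → j ≢ k × c i ~ c j × c i ~ c k
  cycle-neighbours (c , _ , step , close) zero = suc zero , fromℕ _ , (λ ()) , step zero , ~-sym close
  cycle-neighbours (c , _ , step , close) (suc i) with view i
  ... | ‵fromℕ     = inject₁ i , zero , (λ ()) , ~-sym (step i) , close
  ... | ‵inject₁ j = inject₁ i , suc (suc j) , apart , ~-sym (step i) , step (suc j)
    where
    apart : inject₁ (inject₁ j) ≢ suc (suc j)
    apart eq = ℕ.<⇒≢ (ℕ.m<n⇒m<1+n (ℕ.n<1+n (toℕ j))) (begin
      toℕ j                       ≡⟨ Fin.toℕ-inject₁ j ⟨
      toℕ (inject₁ j)             ≡⟨ Fin.toℕ-inject₁ (inject₁ j) ⟨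
      toℕ (inject₁ (inject₁ j))   ≡⟨ cong toℕ eq ⟩
      2 + toℕ j                   ∎)
      where open ≡-Reasoning

-- Enumeration of permutations

permutations : ∀ n → List (Permutation′ n)
permutations zero    = id ∷ []
permutations (suc n) = cartesianProductWith (insert zero) (allFin (suc n)) (permutations n)

-- `insert-remove` rebuilds `π` from the image of `zero` and the permutation induced on the
-- remaining points.
permutations-exhaust : ∀ {n} (π : Permutation′ n) → Any (π ≈ₚ_) (permutations n)
permutations-exhaust {zero}  π = here λ ()
permutations-exhaust {suc n} π = Any.cartesianProductWith⁺ (insert zero)
  (λ { refl p zero → sym (insert-remove zero π zero)
     ; {y = ρ} refl p (suc i) → trans (sym (insert-remove zero π (suc i))) (cong (punchIn _) (p i)) })
  (∈-allFin (π ⟨$⟩ʳ zero)) (permutations-exhaust (remove zero π))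

-- Counting the cycles of a permutation

-- Induction on `n`: once the successors are labelled, `zero` either takes the label of some related
-- `suc r` or opens a new class.
quotient : ∀ {n} {_~_ : Rel (Fin n) 0ℓ} → IsEquivalence _~_ → Decidable _~_ →
  ∃[ c ] Σ[ label ∈ (Fin n → Fin c) ]
    Surjective _≡_ _≡_ label × (∀ i j → label i ≡ label j ⇔ i ~ j)
quotient {zero} _ _ = 0 , (λ ()) , (λ ()) , λ ()
quotient {suc n} {_~_} isEquiv _~?_
  with quotient (On.isEquivalence suc isEquiv) (λ i j → suc i ~? suc j)
     | Fin.any? (λ j → zero ~? suc j)
... | c , label , surjective , kernel | yes (r , 0~r) = c , label′ , surjective′ , kernel′
  where
  open IsEquivalence isEquiv renaming (refl to ~-refl; sym to ~-sym; trans to ~-trans)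
  label′ : Fin (suc n) → Fin c
  label′ zero    = label r
  label′ (suc i) = label i
  surjective′ : Surjective _≡_ _≡_ label′
  surjective′ y with x , hit ← surjective y = suc x , λ { refl → hit refl }
  kernel′ : ∀ i j → label′ i ≡ label′ j ⇔ i ~ j
  kernel′ zero    zero    = mk⇔ (λ _ → ~-refl) (λ _ → refl)
  kernel′ zero    (suc j) = mk⇔ (~-trans 0~r ∘ to) (from ∘ ~-trans (~-sym 0~r))
    where open Equivalence (kernel r j)
  kernel′ (suc i) zero    = mk⇔ (λ eq → ~-trans (to eq) (~-sym 0~r)) (λ i~0 → from (~-trans i~0 0~r))
    where open Equivalence (kernel i r)
  kernel′ (suc i) (suc j) = kernel i j
... | c , label , surjective , kernel | no 0-alone = suc c , label′ , surjective′ , kernel′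
  where
  open IsEquivalence isEquiv renaming (refl to ~-refl; sym to ~-sym; trans to ~-trans)
  label′ : Fin (suc n) → Fin (suc c)
  label′ zero    = zero
  label′ (suc i) = suc (label i)
  surjective′ : Surjective _≡_ _≡_ label′
  surjective′ zero = zero , λ { refl → refl }
  surjective′ (suc y) with x , hit ← surjective y = suc x , λ { refl → cong suc (hit refl) }
  kernel′ : ∀ i j → label′ i ≡ label′ j ⇔ i ~ j
  kernel′ zero    zero    = mk⇔ (λ _ → ~-refl) (λ _ → refl)
  kernel′ zero    (suc j) = mk⇔ (λ ()) (λ 0~j → contradiction (j , 0~j) 0-alone)
  kernel′ (suc i) zero    = mk⇔ (λ ()) (λ i~0 → contradiction (i , ~-sym i~0) 0-alone)
  kernel′ (suc i) (suc j) = mk⇔ (to ∘ Fin.suc-injective) (cong suc ∘ from)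
    where open Equivalence (kernel i j)

module _ {A : Set} (f : A → A) where

  iterate-+ : ∀ x a b → iterate f x (a + b) ≡ iterate f (iterate f x a) b
  iterate-+ x zero    b = refl
  iterate-+ x (suc a) b = iterate-+ (f x) a b

  iterate-* : ∀ x q p → iterate f x p ≡ x → iterate f x (q * p) ≡ x
  iterate-* x zero    p eq = refl
  iterate-* x (suc q) p eq = begin
    iterate f x (p + q * p)             ≡⟨ iterate-+ x p (q * p) ⟩
    iterate f (iterate f x p) (q * p)   ≡⟨ cong (λ y → iterate f y (q * p)) eq ⟩
    iterate f x (q * p)                 ≡⟨ iterate-* x q p eq ⟩
    x                                   ∎
    where open ≡-Reasoning

  iterate-injective : Injective _≡_ _≡_ f → ∀ {x y} k → iterate f x k ≡ iterate f y k → x ≡ y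
  iterate-injective inj zero    eq = eq
  iterate-injective inj (suc k) eq = inj (iterate-injective inj k eq)

iterate-cong : ∀ {A : Set} {f g : A → A} → f ≗ g → ∀ x k → iterate f x k ≡ iterate g x k
iterate-cong f≗g x zero = refl
iterate-cong {f = f} {g} f≗g x (suc k) =
  trans (cong (λ y → iterate f y k) (f≗g x)) (iterate-cong f≗g (g x) k)

module _ {n} (π : Permutation′ n) where
  private
    f : Fin n → Fin n
    f = π ⟨$⟩ʳ_

  -- Among the iterates with exponents `0` to `n` two coincide by pigeonhole, and injectivity
  -- cancels the smaller exponent.
  period : ∀ i → ∃[ p ] iterate f i (suc p) ≡ i
  period i
    with a , b , a<b , fᵃ≡fᵇ ← Fin.pigeonhole (ℕ.n<1+n n) (iterate f i ∘ toℕ)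
    with p , a+p≡b ← ℕ.m≤n⇒∃[o]m+o≡n a<b =
    p , iterate-injective f (Injection.injective (↔⇒↣ π)) (toℕ a) (begin
      iterate f (iterate f i (suc p)) (toℕ a)   ≡⟨ iterate-+ f i (suc p) (toℕ a) ⟨
      iterate f i (suc p + toℕ a)               ≡⟨ cong (iterate f i) (cong suc (ℕ.+-comm p (toℕ a))) ⟩
      iterate f i (suc (toℕ a + p))             ≡⟨ cong (iterate f i) a+p≡b ⟩
      iterate f i (toℕ b)                       ≡⟨ fᵃ≡fᵇ ⟨
      iterate f i (toℕ a)                       ∎)
    where open ≡-Reasoning

  sameCycle-isEquivalence : IsEquivalence (SameCycle π)
  sameCycle-isEquivalence = record
    { refl  = 0 , refl
    ; sym   = λ { {i} (k , refl) → let p , fᵖ = period i in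
        -- After `k` steps, `k * p` more make `k * suc p` in total, a multiple of the period.
        k * p , (begin
          iterate f (iterate f i k) (k * p)   ≡⟨ iterate-+ f i k (k * p) ⟨
          iterate f i (k + k * p)             ≡⟨ cong (iterate f i) (ℕ.*-suc k p) ⟨
          iterate f i (k * suc p)             ≡⟨ iterate-* f i k (suc p) fᵖ ⟩
          i                                   ∎) }
    ; trans = λ { {i} (a , refl) (b , refl) → a + b , iterate-+ f i a b }
    }
    where open ≡-Reasoning

  -- Exponents matter only modulo the period, so a search over `Fin (suc p)` suffices.
  sameCycle? : Decidable (SameCycle π)
  sameCycle? i j with p , fᵖ ← period i =
    map′ (λ (r , eq) → toℕ r , eq) (λ { (k , refl) → fromℕ< (m%n<n k (suc p)) , reduce k })
         (Fin.any? λ (r : Fin (suc p)) → iterate f i (toℕ r) Fin.≟ j)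
    where
    open ≡-Reasoning
    reduce : ∀ k → iterate f i (toℕ (fromℕ< (m%n<n k (suc p)))) ≡ iterate f i k
    reduce k = begin
      iterate f i (toℕ (fromℕ< (m%n<n k (suc p))))
        ≡⟨ cong (iterate f i) (Fin.toℕ-fromℕ< (m%n<n k (suc p))) ⟩
      iterate f i (k % suc p)
        ≡⟨ cong (λ y → iterate f y (k % suc p)) (iterate-* f i (k / suc p) (suc p) fᵖ) ⟨
      iterate f (iterate f i (k / suc p * suc p)) (k % suc p)
        ≡⟨ iterate-+ f i (k / suc p * suc p) (k % suc p) ⟨
      iterate f i (k / suc p * suc p + k % suc p)
        ≡⟨ cong (iterate f i) (ℕ.+-comm (k / suc p * suc p) (k % suc p)) ⟩
      iterate f i (k % suc p + k / suc p * suc p)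
        ≡⟨ cong (iterate f i) (m≡m%n+[m/n]*n k (suc p)) ⟨
      iterate f i k ∎

  cycles-exist : ∃[ c ] HasCycles π c
  cycles-exist = quotient sameCycle-isEquivalence sameCycle?

hasCycles-resp : ∀ {n c} {π ρ : Permutation′ n} → π ≈ₚ ρ → HasCycles π c → HasCycles ρ c
hasCycles-resp π≈ρ (label , surjective , kernel) = label , surjective , λ i j →
  let open Equivalence (kernel i j) in
  mk⇔ (λ eq → let k , πᵏ = to eq in k , trans (sym (iterate-cong π≈ρ i k)) πᵏ)
      (λ (k , ρᵏ) → from (k , trans (iterate-cong π≈ρ i k) ρᵏ))

-- Existence of the diameter upper bound and of the diameter

module _ {n} (T : Tree n) where
  open Tree T

  treeDist-exists : ∀ u v → ∃[ d ] IsDist graph u v d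
  treeDist-exists = dist-exists graph Fin._≟_ (allFin n) ∈-allFin connected

  boundTerm-resp : ∀ {π ρ v} → π ≈ₚ ρ → BoundTerm T π v → BoundTerm T ρ v
  boundTerm-resp {π} {ρ} π≈ρ (c , d , cycles , dists , eq) =
    c , d , hasCycles-resp {π = π} {ρ} π≈ρ cycles ,
    (λ i → subst (λ j → IsDist graph i j (d i)) (π≈ρ i) (dists i)) , eq

  diameterUpperBound-exists : ∃[ f ] IsDiameterUpperBound T f
  diameterUpperBound-exists = maximum-exists ℤ.≤-isTotalOrder {R = BoundTerm T} id (permutations n)
    (λ π → Any.map (λ {ρ} π≈ρ _ → boundTerm-resp {ρ} {π} (sym ∘ π≈ρ)) (permutations-exhaust π))
    (λ π → let c , cycles = cycles-exist π in
      _ , c , (λ i → proj₁ (treeDist-exists i (π ⟨$⟩ʳ i))) , cycles ,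
      (λ i → proj₂ (treeDist-exists i (π ⟨$⟩ʳ i))) , refl)

  cayleyDiameter-exists : Connected (Cayley graph) → ∃[ D ] IsDiameter (Cayley graph) D
  cayleyDiameter-exists conn = diameter-exists (Cayley graph)
    (λ π ρ → Fin.all? λ i → (π ⟨$⟩ʳ i) Fin.≟ (ρ ⟨$⟩ʳ i))
    (permutations n) permutations-exhaust conn id

-- The fork tree

depth : ∀ {m} → Fin (4 + m) → ℕ
depth {m} i = toℕ i ⊓ (2 + m)

-- The path 0 – 1 – ⋯ – (2 + m) with one further leaf 3 + m at 1 + m, rooted at 0;
-- the truncation makes both 2 + m and 3 + m children of 1 + m.
ChildOf : ∀ {m} → Rel (Fin (4 + m)) 0ℓ
ChildOf i j = depth i ≡ suc (toℕ j)

childOf⇒< : ∀ {m} {i j : Fin (4 + m)} → ChildOf i j → toℕ j < toℕ i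
childOf⇒< {m} {i} i⇒j = subst (_≤ toℕ i) i⇒j (ℕ.m⊓n≤m (toℕ i) (2 + m))

fork : ∀ m → SimpleGraph (≡.setoid (Fin (4 + m)))
fork m = record
  { _~_      = λ i j → ChildOf i j ⊎ ChildOf j i
  ; ~-resp-≈ = (λ { refl i~j → i~j }) , λ { refl i~j → i~j }
  ; ~-sym    = Sum.swap
  ; ~-irrefl = λ { {i} refl → Sum.[ loop {i} , loop {i} ] }
  ; _~?_     = λ i j → (depth i ℕ.≟ suc (toℕ j)) ⊎-dec (depth j ℕ.≟ suc (toℕ i))
  }
  where
  loop : ∀ {i : Fin (4 + m)} → ¬ ChildOf i i
  loop {i} = ℕ.<-irrefl refl ∘ childOf⇒< {i = i}

childOf⇒depth : ∀ {m} {i j : Fin (4 + m)} → ChildOf i j → depth i ≡ suc (depth j)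
childOf⇒depth {m} {i} {j} i⇒j = trans i⇒j (cong suc (sym (ℕ.m≤n⇒m⊓n≡m
  (ℕ.<⇒≤ (subst (_≤ 2 + m) i⇒j (ℕ.m⊓n≤n (toℕ i) (2 + m)))))))

depth≡0⇒root : ∀ {m} (i : Fin (4 + m)) → depth i ≡ 0 → i ≡ zero
depth≡0⇒root zero _ = refl

-- The parent is the vertex with index `l`. As `suc l` is at most `2 + m`, the truncation does not
-- affect it, and its depth equals its index.
parent : ∀ {m l} (i : Fin (4 + m)) → depth i ≡ suc l → ∃[ j ] ChildOf i j × depth j ≡ l
parent {m} {l} i eq = fromℕ< l<n , i⇒j , ℕ.suc-injective (trans (sym (childOf⇒depth {i = i} i⇒j)) eq)
  where
  l<n : l < 4 + m
  l<n = ℕ.≤-trans (subst (_≤ 2 + m) eq (ℕ.m⊓n≤n (toℕ i) (2 + m))) (ℕ.m≤n+m (2 + m) 2)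
  i⇒j : ChildOf i (fromℕ< l<n)
  i⇒j = trans eq (cong suc (sym (Fin.toℕ-fromℕ< l<n)))

descend : ∀ {m} l (i : Fin (4 + m)) → depth i ≡ l → Walk (fork m) i zero l
descend zero    i eq = nil (depth≡0⇒root i eq)
descend (suc l) i eq with j , i⇒j , eq′ ← parent i eq = cons (inj₁ i⇒j) (descend l j eq′)

fork-connected : ∀ m → Connected (fork m)
fork-connected m i j =
  _ , append (fork m) (descend _ i refl) (reverse (fork m) (descend _ j refl))

-- A vertex of a cycle with maximal index would have two distinct parents.
fork-acyclic : ∀ m → Acyclic (fork m)
fork-acyclic m k cycle@(c , c-inj , _) =
  let j₁ , j₂ , j₁≢j₂ , ~j₁ , ~j₂ = cycle-neighbours (fork m) cycle top
  in j₁≢j₂ (c-inj (Fin.toℕ-injective (ℕ.suc-injective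
       (trans (sym (parent-of ~j₁)) (parent-of ~j₂)))))
  where
  top : Fin (3 + k)
  top = argmax ℕ.≤-totalOrder (toℕ ∘ c) zero (allFin _)
  parent-of : ∀ {j} → ChildOf (c top) (c j) ⊎ ChildOf (c j) (c top) → ChildOf (c top) (c j)
  parent-of (inj₁ child) = child
  parent-of {j} (inj₂ parent) = contradiction
    (ℕ.<-≤-trans (childOf⇒< {i = c j} parent)
      (All.lookup (f[xs]≤f[argmax] ℕ.≤-totalOrder {f = toℕ ∘ c} zero (allFin _)) (∈-allFin j)))
    (ℕ.<-irrefl refl)

forkTree : ∀ m → Tree (4 + m)
forkTree m = record { graph = fork m ; connected = fork-connected m ; acyclic = fork-acyclic m }

-- Each edge changes the depth by exactly one, so depth differences bound distances from below.
walk-depth : ∀ {m} {i j : Fin (4 + m)} {k} → Walk (fork m) i j k → ∣ depth i - depth j ∣ ≤ k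
walk-depth {i = i} (nil refl) = ℕ.≤-reflexive (ℕ.∣n-n∣≡0 (depth i))
walk-depth {i = i} {j} (cons {v = v} i~v v⇝j) =
  ℕ.≤-trans (ℕ.∣-∣-triangle (depth i) (depth v) (depth j)) (ℕ.+-mono-≤ (one i~v) (walk-depth v⇝j))
  where
  ∣1+n-n∣≡1 : ∀ n → ∣ suc n - n ∣ ≡ 1
  ∣1+n-n∣≡1 n = trans (ℕ.∣-∣-comm (suc n) n) (trans (cong ∣ n -_∣ (ℕ.+-comm 1 n)) (ℕ.∣m-m+n∣≡n n 1))
  one : ChildOf i v ⊎ ChildOf v i → ∣ depth i - depth v ∣ ≤ 1
  one (inj₁ i⇒v) rewrite childOf⇒depth {i = i} {v} i⇒v = ℕ.≤-reflexive (∣1+n-n∣≡1 (depth v))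
  one (inj₂ v⇒i) rewrite childOf⇒depth {i = v} {i} v⇒i =
    ℕ.≤-reflexive (trans (ℕ.∣-∣-comm (depth i) (suc (depth i))) (∣1+n-n∣≡1 (depth i)))

-- Upper bound on the diameter

triangle : ℕ → ℕ
triangle zero    = 0
triangle (suc n) = suc n + triangle n

transpose-matchʳ : ∀ {n} (i j : Fin n) → PC.transpose i j j ≡ i
transpose-matchʳ i j with j Fin.≟ i
... | yes j≡i = j≡i
... | no _ rewrite dec-true (j Fin.≟ j) refl = refl

-- Generators multiply on the right, so left multiplication by `π` preserves adjacency.
translate : ∀ {n} (G : SimpleGraph (≡.setoid (Fin n))) {g h k} (π : Permutation′ n) →
  Walk (Cayley G) g h k → Walk (Cayley G) (π · g) (π · h) k
translate G π (nil g≈h) = nil (cong (π ⟨$⟩ʳ_) ∘ g≈h)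
translate G π (cons {v = v} (i , j , i~j , v≈gs) v⇝h) =
  cons {v = π · v} (i , j , i~j , cong (π ⟨$⟩ʳ_) ∘ v≈gs) (translate G π v⇝h)

-- Deleting the leaf `zero` from the longer fork leaves the shorter one with indices shifted by
-- `suc`, so exchanges there lift to exchanges that do not touch `zero`.
lift-walk : ∀ {m g h k} → Walk (Cayley (fork m)) g h k →
  Walk (Cayley (fork (suc m))) (lift₀ g) (lift₀ h) k
lift-walk (nil g≈h) = nil λ { zero → refl ; (suc x) → cong suc (g≈h x) }
lift-walk {g = g} (cons {v = v} (i , j , i~j , v≈gs) v⇝h) = cons {v = lift₀ v}
  (suc i , suc j , Sum.map (cong suc) (cong suc) i~j , λ
    { zero    → refl
    ; (suc x) → trans (cong suc (v≈gs x)) (sym (cong (lift₀ g ⟨$⟩ʳ_) (lift₀-transpose i j (suc x)))) })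
  (lift-walk v⇝h)

-- Read `σ ⟨$⟩ʳ p` as the token at position `p`; a generator swaps the tokens at the ends of an
-- edge. Token `zero` moves to the parent position each time, so its depth counts the exchanges.
carry-home : ∀ {m} l p (σ : Permutation′ (4 + m)) → depth p ≡ l → σ ⟨$⟩ʳ p ≡ zero →
  ∃[ ρ ] ρ ⟨$⟩ʳ zero ≡ zero × Walk (Cayley (fork m)) σ ρ l
carry-home zero p σ eq σp≡0 with refl ← depth≡0⇒root p eq = σ , σp≡0 , nil λ _ → refl
carry-home (suc l) p σ eq σp≡0
  with q , p⇒q , eq′ ← parent p eq
  with ρ , ρ0≡0 , σ′⇝ρ ← carry-home l q (σ · transpose p q) eq′
                            (trans (cong (σ ⟨$⟩ʳ_) (transpose-matchʳ p q)) σp≡0)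
  = ρ , ρ0≡0 , cons {v = σ · transpose p q} (p , q , inj₁ p⇒q , λ _ → refl) σ′⇝ρ

-- Exchanging position 1 with itself is a pause, so "exactly k" allows fewer exchanges.
StarSortable : ℕ → (Fin 4 → Fin 4) → Set
StarSortable zero    f = ∀ x → f x ≡ x
StarSortable (suc k) f = ∃[ i ] StarSortable k (f ∘ PC.transpose 1F i)

starSortable-cong : ∀ k {f g} → f ≗ g → StarSortable k f → StarSortable k g
starSortable-cong zero    f≗g sorted       = λ x → trans (sym (f≗g x)) (sorted x)
starSortable-cong (suc k) f≗g (i , sorted) = i , starSortable-cong k (f≗g ∘ PC.transpose 1F i) sorted

starSortable? : ∀ k f → Dec (StarSortable k f)
starSortable? zero    f = Fin.all? λ x → f x Fin.≟ x
starSortable? (suc k) f = Fin.any? λ i → starSortable? k (f ∘ PC.transpose 1F i)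

fromImages : Fin 4 → Fin 4 → Fin 4 → Fin 4 → Fin 4 → Fin 4
fromImages a b c d 0F = a
fromImages a b c d 1F = b
fromImages a b c d 2F = c
fromImages a b c d 3F = d

-- Settled by evaluating a decision procedure. Giving a map by its four images turns the
-- quantification over maps into one over finite types.
all-starSortable : ∀ a b c d → let f = fromImages a b c d in
  (∀ x y → f x ≡ f y → x ≡ y) → StarSortable 4 f
all-starSortable = from-yes
  (Fin.all? λ a → Fin.all? λ b → Fin.all? λ c → Fin.all? λ d → let f = fromImages a b c d in
    (Fin.all? λ x → Fin.all? λ y → (f x Fin.≟ f y) →-dec (x Fin.≟ y)) →-dec starSortable? 4 f)

starSortable⇒walk : ∀ k (σ : Permutation′ 4) → StarSortable k (σ ⟨$⟩ʳ_) →
  ∃[ l ] l ≤ k × Walk (Cayley (fork 0)) σ id l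
starSortable⇒walk zero    σ sorted = 0 , z≤n , nil sorted
starSortable⇒walk (suc k) σ (i , sorted)
  with l , l≤k , rest ← starSortable⇒walk k (σ · transpose 1F i) sorted = prepend i rest
  where
  exchange : ∀ i → SimpleGraph._~_ (fork 0) 1F i → Walk (Cayley (fork 0)) (σ · transpose 1F i) id l →
    ∃[ l ] l ≤ suc k × Walk (Cayley (fork 0)) σ id l
  exchange i 1~i walk = suc l , s≤s l≤k , cons {v = σ · transpose 1F i} (1F , i , 1~i , λ _ → refl) walk
  prepend : ∀ i → Walk (Cayley (fork 0)) (σ · transpose 1F i) id l →
    ∃[ l ] l ≤ suc k × Walk (Cayley (fork 0)) σ id l
  prepend 0F walk = exchange 0F (inj₁ refl) walk
  -- A pause: `transpose 1F 1F` is the identity, so no edge is added.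
  prepend 1F walk = l , ℕ.m≤n⇒m≤1+n l≤k , walk-respˡ (Cayley (fork 0)) {u = σ · transpose 1F 1F} {v = σ}
    (λ { 0F → refl ; 1F → refl ; 2F → refl ; 3F → refl }) walk
  prepend 2F walk = exchange 2F (inj₂ refl) walk
  prepend 3F walk = exchange 3F (inj₂ refl) walk

-- The star on four vertices costs at most `4`, which is `1 + triangle 2`. Passing to the fork for
-- `suc m` adds at most its maximal depth `3 + m`, the next summand of `triangle`.
sort : ∀ m (σ : Permutation′ (4 + m)) →
  ∃[ k ] k ≤ 1 + triangle (2 + m) × Walk (Cayley (fork m)) σ id k
sort zero σ = starSortable⇒walk 4 σ (starSortable-cong 4 images
  (all-starSortable (σ ⟨$⟩ʳ 0F) (σ ⟨$⟩ʳ 1F) (σ ⟨$⟩ʳ 2F) (σ ⟨$⟩ʳ 3F)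
    λ x y eq → Injection.injective (↔⇒↣ σ) (trans (sym (images x)) (trans eq (images y)))))
  where
  images : fromImages _ _ _ _ ≗ (σ ⟨$⟩ʳ_)
  images 0F = refl
  images 1F = refl
  images 2F = refl
  images 3F = refl
sort (suc m) σ
  with ρ , ρ0≡0 , σ⇝ρ ← carry-home _ (σ ⟨$⟩ˡ zero) σ refl (inverseʳ σ)
  -- Since `ρ` fixes `zero`, it is the lift of `remove zero ρ`, which is sorted on the shorter fork.
  with k , k≤ , ρ′⇝id ← sort m (remove zero ρ) =
  _ ,
  ℕ.≤-trans (ℕ.+-mono-≤ (ℕ.m⊓n≤n (toℕ (σ ⟨$⟩ˡ zero)) (3 + m)) k≤)
            (ℕ.≤-reflexive (ℕ.+-suc (3 + m) (triangle (2 + m)))) ,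
  append (Cayley (fork (suc m))) σ⇝ρ
    (walk-respˡ (Cayley (fork (suc m))) {u = lift₀ (remove zero ρ)} {v = ρ} (lift₀-remove ρ ρ0≡0)
      (walk-respʳ (Cayley (fork (suc m))) {v = lift₀ id} {w = id}
        (λ { zero → refl ; (suc _) → refl }) (lift-walk ρ′⇝id)))

-- Sorting the quotient of `g` by `h` gives a walk to `id`; left translation by `h` makes it a walk
-- from `g` to `h`.
short-walk : ∀ m (g h : Permutation′ (4 + m)) →
  ∃[ k ] k ≤ 1 + triangle (2 + m) × Walk (Cayley (fork m)) g h k
short-walk m g h with k , k≤ , walk ← sort m (flip h · g) =
  k , k≤ , walk-respˡ (Cayley (fork m)) {u = h · (flip h · g)} {v = g} (λ _ → inverseʳ h)
             (walk-respʳ (Cayley (fork m)) {v = h · id} {w = h} (λ _ → refl)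
               (translate (fork m) h walk))

diameter≤ : ∀ m {D} → IsDiameter (Cayley (fork m)) D → D ≤ 1 + triangle (2 + m)
diameter≤ m (((g , h) , _ , shortest) , _) with k , k≤ , walk ← short-walk m g h =
  ℕ.≤-trans (shortest k walk) k≤

-- Displacement and cycles of the reversal

sum-mono : ∀ {n} {s t : Vector ℕ n} → (∀ i → s i ≤ t i) → sum s ≤ sum t
sum-mono {zero}  s≤t = z≤n
sum-mono {suc n} s≤t = ℕ.+-mono-≤ (s≤t zero) (sum-mono (s≤t ∘ suc))

opposite-inject₁ : ∀ {n} (i : Fin n) → opposite (inject₁ i) ≡ suc (opposite i)
opposite-inject₁ zero    = refl
opposite-inject₁ (suc i) = cong inject₁ (opposite-inject₁ i)

opposite-fromℕ : ∀ n → opposite (fromℕ n) ≡ zero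
opposite-fromℕ zero    = refl
opposite-fromℕ (suc n) = cong inject₁ (opposite-fromℕ n)

-- The total displacement of the reversal, measured in a coordinate `φ`: `depth` for the fork, `toℕ`
-- for a path.
spread : ∀ {n} → Vector ℕ n → ℕ
spread φ = sum λ i → ∣ φ i - φ (opposite i) ∣

spread-cong : ∀ {n} {φ ψ : Vector ℕ n} → φ ≗ ψ → spread φ ≡ spread ψ
spread-cong φ≗ψ = sum-cong-≗ λ i → cong₂ ∣_-_∣ (φ≗ψ i) (φ≗ψ (opposite i))

-- The reversal swaps the two ends and restricts to the reversal of the points between, which gives
-- a recursion in steps of two.
spread-ends : ∀ {n} (φ : Vector ℕ (2 + n)) → let end = ∣ φ zero - φ (fromℕ (suc n)) ∣ in
  spread φ ≡ end + (spread (φ ∘ suc ∘ inject₁) + end)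
spread-ends {n} φ = cong (∣ φ zero - φ (fromℕ (suc n)) ∣ +_) (begin
  sum (λ i → ∣ φ (suc i) - φ (opposite (suc i)) ∣)
    ≡⟨ sum-init-last (λ i → ∣ φ (suc i) - φ (opposite (suc i)) ∣) ⟩
  sum (λ i → ∣ φ (suc (inject₁ i)) - φ (inject₁ (opposite (inject₁ i))) ∣)
    + ∣ φ (fromℕ (suc n)) - φ (opposite (fromℕ (suc n))) ∣
    ≡⟨ cong₂ _+_
         (sum-cong-≗ λ i → cong (λ j → ∣ φ (suc (inject₁ i)) - φ (inject₁ j) ∣) (opposite-inject₁ i))
         (trans (cong (λ j → ∣ φ (fromℕ (suc n)) - φ j ∣) (opposite-fromℕ (suc n)))
                (ℕ.∣-∣-comm (φ (fromℕ (suc n))) (φ zero))) ⟩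
  spread (φ ∘ suc ∘ inject₁) + ∣ φ zero - φ (fromℕ (suc n)) ∣ ∎)
  where open ≡-Reasoning

-- Two new end points add one to `⌈ n /2⌉` and `2 * (n + 1)` to the displacement, together the two
-- new summands of `triangle`.
spread-toℕ : ∀ n → ⌈ n /2⌉ + spread {n} toℕ ≡ triangle n
spread-toℕ zero          = refl
spread-toℕ (suc zero)    = refl
spread-toℕ (suc (suc n)) = begin
  suc ⌈ n /2⌉ + spread {2 + n} toℕ
    ≡⟨ cong (suc ⌈ n /2⌉ +_) (spread-ends {n} toℕ) ⟩
  suc ⌈ n /2⌉ + (e + (spread {n} (λ i → suc (toℕ (inject₁ i))) + e))
    ≡⟨ cong (λ s → suc ⌈ n /2⌉ + (e + (s + e))) (spread-cong {n} λ i → cong suc (Fin.toℕ-inject₁ i)) ⟩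
  suc ⌈ n /2⌉ + (e + (spread {n} toℕ + e))
    ≡⟨ rearrange ⌈ n /2⌉ e (spread {n} toℕ) ⟩
  suc e + (e + (⌈ n /2⌉ + spread {n} toℕ))
    ≡⟨ cong₂ (λ e s → suc e + (e + s)) (Fin.toℕ-fromℕ (suc n)) (spread-toℕ n) ⟩
  triangle (2 + n) ∎
  where
  open ≡-Reasoning
  e : ℕ
  e = toℕ (fromℕ (suc n))
  rearrange : ∀ h e s → suc h + (e + (s + e)) ≡ suc e + (e + (h + s))
  rearrange = solve-∀

-- The truncation acts only on the last vertex. Without the two ends, `depth` is `toℕ` shifted by
-- one, so the inner part is a path on `2 + m` points. The term `2 + ⌈ m /2⌉` is `⌈ 4 + m /2⌉`, the
-- cycle count of the reversal.
spread-depth : ∀ m → 2 + ⌈ m /2⌉ + spread (depth {m}) ≡ 5 + 2 * m + triangle (2 + m)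
spread-depth m = begin
  2 + ⌈ m /2⌉ + spread (depth {m})
    ≡⟨ cong (2 + ⌈ m /2⌉ +_) (spread-ends (depth {m})) ⟩
  2 + ⌈ m /2⌉ + (e + (spread (depth {m} ∘ suc ∘ inject₁) + e))
    ≡⟨ cong₂ (λ e s → 2 + ⌈ m /2⌉ + (e + (s + e))) depth-last (spread-cong depth-inner) ⟩
  2 + ⌈ m /2⌉ + (2 + m + (spread {2 + m} toℕ + (2 + m)))
    ≡⟨ rearrange ⌈ m /2⌉ m (spread {2 + m} toℕ) ⟩
  5 + 2 * m + (⌈ 2 + m /2⌉ + spread {2 + m} toℕ)
    ≡⟨ cong (5 + 2 * m +_) (spread-toℕ (2 + m)) ⟩
  5 + 2 * m + triangle (2 + m) ∎
  where
  open ≡-Reasoning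
  e : ℕ
  e = depth (fromℕ (3 + m))
  depth-last : e ≡ 2 + m
  depth-last = trans (cong (_⊓ (2 + m)) (Fin.toℕ-fromℕ (3 + m))) (ℕ.m≥n⇒m⊓n≡n (ℕ.n≤1+n (2 + m)))
  depth-inner : depth {m} ∘ suc ∘ inject₁ ≗ suc ∘ toℕ
  depth-inner i = trans (cong (λ k → suc k ⊓ (2 + m)) (Fin.toℕ-inject₁ i)) (ℕ.m≤n⇒m⊓n≡m (Fin.toℕ<n i))
  rearrange : ∀ h m s → 2 + h + (2 + m + (s + (2 + m))) ≡ 5 + 2 * m + (suc h + s)
  rearrange = solve-∀

iterate-involutive : ∀ {A : Set} {f : A → A} → (∀ x → f (f x) ≡ x) →
  ∀ x k → iterate f x k ≡ x ⊎ iterate f x k ≡ f x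
iterate-involutive inv x zero    = inj₁ refl
iterate-involutive {f = f} inv x (suc k) with iterate-involutive inv (f x) k
... | inj₁ eq = inj₂ eq
... | inj₂ eq = inj₁ (trans eq (inv x))

-- Two mirrored positions in the first half must both be central: `b < ⌈ n /2⌉` forces `a` up to at
-- least `⌊ n /2⌋`, and `a < ⌈ n /2⌉` allows no more.
middle : ∀ n {a b} → a < ⌈ n /2⌉ → b < ⌈ n /2⌉ → a + suc b ≡ n → a ≡ ⌊ n /2⌋
middle n {a} {b} a<h b<h eq = ℕ.≤-antisym
  (ℕ.≤-pred (ℕ.≤-trans a<h (ℕ.⌊n/2⌋-mono (ℕ.n≤1+n (suc n)))))
  (ℕ.+-cancelʳ-≤ ⌈ n /2⌉ ⌊ n /2⌋ a (begin
    ⌊ n /2⌋ + ⌈ n /2⌉   ≡⟨ ℕ.⌊n/2⌋+⌈n/2⌉≡n n ⟩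
    n                   ≡⟨ eq ⟨
    a + suc b           ≤⟨ ℕ.+-monoʳ-≤ a b<h ⟩
    a + ⌈ n /2⌉         ∎))
  where open ℕ.≤-Reasoning

-- The first ⌈n/2⌉ points lie in different cycles of the reversal.
reversal-cycles : ∀ {n c} → HasCycles (reversal {n}) c → ⌈ n /2⌉ ≤ c
reversal-cycles {n} (label , _ , kernel) = Fin.injective⇒≤ {f = label ∘ embed} injective
  where
  embed : Fin ⌈ n /2⌉ → Fin n
  embed i = inject≤ i (ℕ.⌈n/2⌉≤n n)
  mirrored : ∀ {i j} → opposite (embed i) ≡ embed j → toℕ j + suc (toℕ i) ≡ n
  mirrored {i} {j} eq = begin
    toℕ j + suc (toℕ i)
      ≡⟨ cong (_+ suc (toℕ i)) (Fin.toℕ-inject≤ j (ℕ.⌈n/2⌉≤n n)) ⟨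
    toℕ (embed j) + suc (toℕ i)
      ≡⟨ cong (λ k → toℕ k + suc (toℕ i)) eq ⟨
    toℕ (opposite (embed i)) + suc (toℕ i)
      ≡⟨ cong (_+ suc (toℕ i)) (Fin.opposite-prop (embed i)) ⟩
    n ∸ suc (toℕ (embed i)) + suc (toℕ i)
      ≡⟨ cong (λ k → n ∸ suc k + suc (toℕ i)) (Fin.toℕ-inject≤ i (ℕ.⌈n/2⌉≤n n)) ⟩
    n ∸ suc (toℕ i) + suc (toℕ i)
      ≡⟨ ℕ.m∸n+n≡m (ℕ.≤-trans (Fin.toℕ<n i) (ℕ.⌈n/2⌉≤n n)) ⟩
    n ∎
    where open ≡-Reasoning
  injective : ∀ {i j} → label (embed i) ≡ label (embed j) → i ≡ j
  injective {i} {j} eq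
    with k , πᵏ ← Equivalence.to (kernel (embed i) (embed j)) eq
    with iterate-involutive Fin.opposite-involutive (embed i) k
  ... | inj₁ πᵏ≡ = Fin.inject≤-injective (ℕ.⌈n/2⌉≤n n) (ℕ.⌈n/2⌉≤n n) i j (trans (sym πᵏ≡) πᵏ)
  -- The points are mirror images, so `middle`, applied in both orders, puts both at index
  -- `⌊ n /2⌋`.
  ... | inj₂ πᵏ≡ = Fin.toℕ-injective (trans
    (middle n (Fin.toℕ<n i) (Fin.toℕ<n j)
      (trans (ℕ.+-comm (toℕ i) (suc (toℕ j))) (trans (sym (ℕ.+-suc (toℕ j) (toℕ i))) mirror)))
    (sym (middle n (Fin.toℕ<n j) (Fin.toℕ<n i) mirror)))
    where
    mirror : toℕ j + suc (toℕ i) ≡ n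
    mirror = mirrored {i} {j} (trans (sym πᵏ≡) πᵏ)

-- The gap between the bound and the diameter

open import Data.Integer as ℤ using (ℤ; +_)

≤⇒≤- : ∀ {a b c} → a + b ≤ c → + a ℤ.≤ + c ℤ.- + b
≤⇒≤- {a} {b} {c} a+b≤c = begin
  + a           ≤⟨ ℤ.+≤+ (ℕ.m+n≤o⇒m≤o∸n a a+b≤c) ⟩
  + (c ∸ b)     ≡⟨ ℤ.⊖-≥ (ℕ.m+n≤o⇒n≤o a a+b≤c) ⟨
  c ℤ.⊖ b       ≡⟨ ℤ.m-n≡m⊖n c b ⟨
  + c ℤ.- + b   ∎
  where open ℤ.≤-Reasoning

i≤∣i∣ : ∀ i → i ℤ.≤ + ℤ.∣ i ∣
i≤∣i∣ (+ n)      = ℤ.≤-refl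
i≤∣i∣ ℤ.-[1+ n ] = ℤ.-≤+

-- With `n = 4 + m` this is `n(n - 1)/2 - 2`, written as `m` plus the bound on the diameter so that
-- the gap can be read off.
diameterUpperBound≥ : ∀ m {f} → IsDiameterUpperBound (forkTree m) f →
  + (m + (1 + triangle (2 + m))) ℤ.≤ f
diameterUpperBound≥ m {f} (_ , maximal)
  -- The term at the reversal comes with its own `c` and `d`; `enough` bounds `c` by the cycle count
  -- and each `d i` by a depth difference.
  with _ , (c , d , cycles , dists , refl) , v≤f ← maximal reversal = begin
  + (m + (1 + triangle (2 + m)))           ≤⟨ ≤⇒≤- enough ⟩
  + (c + sum d) ℤ.- + (4 + m)              ≡⟨ ℤ.+-assoc (+ c) (+ sum d) (ℤ.- + (4 + m)) ⟩
  + c ℤ.+ (+ sum d ℤ.- + (4 + m))          ≡⟨ cong (ℤ._+_ (+ c)) (ℤ.+-comm (+ sum d) (ℤ.- + (4 + m))) ⟩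
  + c ℤ.+ (ℤ.- + (4 + m) ℤ.+ + sum d)      ≡⟨ ℤ.+-assoc (+ c) (ℤ.- + (4 + m)) (+ sum d) ⟨
  + c ℤ.- + (4 + m) ℤ.+ + sum d            ≤⟨ v≤f ⟩
  f                                        ∎
  where
  open ℤ.≤-Reasoning
  rearrange : ∀ m t → m + (1 + t) + (4 + m) ≡ 5 + 2 * m + t
  rearrange = solve-∀
  enough : m + (1 + triangle (2 + m)) + (4 + m) ≤ c + sum d
  enough = ℕ.≤-trans
    (ℕ.≤-reflexive (trans (rearrange m (triangle (2 + m))) (sym (spread-depth m))))
    (ℕ.+-mono-≤ (reversal-cycles {4 + m} cycles) (sum-mono λ i → walk-depth (proj₁ (dists i))))

gap≥ : ∀ m {f D} → IsDiameterUpperBound (forkTree m) f → IsDiameter (Cayley (fork m)) D →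
  + m ℤ.≤ f ℤ.- + D
gap≥ m {D = D} isBound isDiameter = ℤ.≤-trans
  (≤⇒≤- (ℕ.+-monoʳ-≤ m (diameter≤ m isDiameter)))
  (ℤ.+-monoˡ-≤ (ℤ.- + D) (diameterUpperBound≥ m isBound))

theorem11 : (n : ℕ) → 5 ≤ n →
    (Σ[ T ∈ Tree n ] Σ[ f ∈ ℤ ] Σ[ D ∈ ℕ ]
    (IsDiameterUpperBound T f ×
    IsDiameter (Cayley (Tree.graph T)) D ×
    (+ n) ℤ.- (+ 4) ℤ.≤ f ℤ.- (+ D)))
    × (∀ (δ : ℕ) → IsΔ n δ → (+ n) ℤ.- (+ 4) ℤ.≤ (+ δ))
-- Writing `n` as `4 + m` makes `+ n ℤ.- + 4` compute to `+ m`.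
theorem11 (suc (suc (suc (suc m)))) (s≤s (s≤s (s≤s (s≤s _)))) =
  largeGap (diameterUpperBound-exists (forkTree m)) (cayleyDiameter-exists (forkTree m) λ g h →
    let k , _ , walk = short-walk m g h in k , walk) ,
  λ { δ (_ , maximal) → Δ≥ δ (maximal (forkTree m)) }
  where
  largeGap : ∃[ f ] IsDiameterUpperBound (forkTree m) f → ∃[ D ] IsDiameter (Cayley (fork m)) D →
    Σ[ T ∈ Tree (4 + m) ] Σ[ f ∈ ℤ ] Σ[ D ∈ ℕ ]
      (IsDiameterUpperBound T f × IsDiameter (Cayley (Tree.graph T)) D × + m ℤ.≤ f ℤ.- + D)
  largeGap (f , isBound) (D , isDiameter) =
    forkTree m , f , D , isBound , isDiameter , gap≥ m isBound isDiameter
  Δ≥ : ∀ δ → ∃[ b ] (IsGap (forkTree m) b × b ≤ δ) → + m ℤ.≤ + δ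
  -- The maximum `δ` dominates the absolute gap of the fork, which in turn dominates the signed one.
  Δ≥ δ (_ , (f , D , isBound , isDiameter , refl) , gap≤δ) = ℤ.≤-trans
    (gap≥ m isBound isDiameter) (ℤ.≤-trans (i≤∣i∣ _) (ℤ.+≤+ gap≤δ))
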